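{- Let $A$ be a set of actions. For every $n\in\mathbb N$, the rule $\mathrm{LCoProof}_n$ is correct for $\mathsf{Mil}$. This statement also holds effectively: for every $n\in\mathbb N$, every derivation $\mathcal D$ in $\mathsf{Mil}+\mathrm{LCoProof}_n$ that consists of a bottommost instance of $\mathrm{LCoProof}_n$ whose immediate subderivations are derivations in $\mathsf{Mil}$ can be transformed effectively into a derivation $\mathcal D'$ in $\mathsf{Mil}$ that has the same conclusion as $\mathcal D$.
   Context: **Star expressions.** For a set $A$ of actions, the set $StExp(A)$ of star expressions is generated by $e ::= 0\mid 1\mid a\mid (e_1+e_2)\mid (e_1\cdot e_2)\mid e^*$ with $a\in A$. $\sum_{i=1}^n e_i$ is $0$ for $n=0$, $e_1$ for $n=1$, and $(\sum_{i=1}^{n-1}e_i)+e_n$ for $n>1$. $Eq(A)$ is the set of formal equations $e=f$ with $e,f\in StExp(A)$. Immediate termination $e{\downarrow}$ is defined inductively by: $1{\downarrow}$; $(e_1+e_2){\downarrow}$ if $e_1{\downarrow}$ or $e_2{\downarrow}$; $(e_1\cdot e_2){\downarrow}$ if $e_1{\downarrow}$ and $e_2{\downarrow}$; $(e^*){\downarrow}$ always. Write $e{\not\downarrow}$ if $e{\downarrow}$ does not hold. **Proof systems.** An $Eq(A)$-based proof system is a Hilbert-style proof system whose formulas are the equations in $Eq(A)$; $e=_S f$ means that $e=f$ is derivable in $S$ without assumptions. It is $\mathcal{EL}$-based if its rules include those of equational logic: reflexivity, symmetry, transitivity, and the context rule (from $e=f$ infer $C[e]=C[f]$ for one-hole star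 expression contexts $C$). $S+\Gamma$ adds the equations in $\Gamma\subseteq Eq(A)$ as axioms to $S$; $S+R$ adds the rule $R$. A rule $R$ is correct for $S$ if for every derivation $\mathcal D$ in $S+R$ without assumptions that terminates with an instance of $R$ but all of whose immediate subderivations are derivations in $S$ there is a derivation in $S$ without assumptions and with the same conclusion as $\mathcal D$. $\mathsf{ACI}$ consists of the axioms $(e+f)+g=e+(f+g)$, $e+f=f+e$, $e+e=e$; $\mathsf{ACI}\sqsubseteq S$ means that all of these are axioms of $S$. $\mathsf{Mil}^-$ is the $\mathcal{EL}$-based system with exactly the rules of equational logic and the axiom schemes: $(e+f)+g=e+(f+g)$, $e+0=e$, $e+f=f+e$, $e+e=e$, $(e\cdot f)\cdot g=e\cdot(f\cdot g)$, $(e+f)\cdot g=e\cdot g+f\cdot g$, $1\cdot e=e$, $e\cdot 1=e$, $0\cdot e=0$, $e^*=1+e\cdot e^*$, $e^*=(1+e)^*$. Milner's system is $\mathsf{Mil}=\mathsf{Mil}^-+\mathrm{RSP}^*$, where $\mathrm{RSP}^*$ is the rule: from $e=f\cdot e+g$ infer $e=f^*\cdot g$, provided $f{\not\downarrow}$. **1-charts and solutions.** A 1-chart is $C=\langle V,A,1,v_s,\to,\downarrow\rangle$ with a finite set $V$ of vertices, a set $A$ of (proper) action labels, an empty-step label $1\notin A$, a start vertex $v_s\in V$, a transition relation $\to\,\subseteq V\times(A\cup\{1\})\times V$, and a set $\downarrow\,\subseteq V$ of vertices with immediate termination. Transitions with label in $A$ are proper; those with label $1$ are 1-transitions. $C$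 is weakly guarded if it has no cycle of 1-transitions. For an $\mathcal{EL}$-based system $S$ with $\mathsf{ACI}\sqsubseteq S$, a function $s:V\to StExp(A)$ is an $S$-provable solution of $C$ if for every $v\in V$: $s(v)=_S\tau_C(v)+\sum_{i=1}^n\underline a_i\cdot s(v_i)$, where $v\xrightarrow{\underline a_i}v_i$ ($1\le i\le n$, $\underline a_i\in A\cup\{1\}$) is a (possibly redundant) list of all transitions from $v$, and $\tau_C(v)$ is $1$ if $v{\downarrow}$ and $0$ otherwise. **Guarded LLEE-1-charts.** A loop 1-chart is a 1-chart such that (L1) there is an infinite path from the start vertex, (L2) every infinite path from the start vertex returns to it after a positive number of transitions, (L3) immediate termination is only permitted at the start vertex. Its transitions from the start vertex are its loop-entry transitions, all other transitions belong to its body. A loop sub-1-chart of $C$ is a loop 1-chart $L$ that is a sub-1-chart of $C$ with some vertex $v$ of $C$ as start vertex, formed, for a nonempty set $U$ of transitions of $C$ from $v$ (the loop-entry transitions of $L$), by all vertices and transitions on paths that start with a transition in $U$ and continue onward until $v$ is reached again. A multi-step loop elimination of loop sub-1-charts $L_1,\dots,L_n$ ($n\ge1$) from $C$, where their sets of loop-entry transitions are pairwise disjoint and no start vertex of one is in the body of another one, removes all loop-entry transitions of $L_1,\dots,L_n$, and then all vertices and transitions that become unreachable. A run (sequence of multi-steps) from $C$ is successful if it leads to a 1-chart without an infinite path; it is layered if it never removes loop-entry transitions that depart from a vertex in the body of a previously eliminated loop sub-1-chart. A LLEE-witness of $C$ is the labeling of the transitions of $C$ by natural numbers that records a successful layered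 run: marking label $n\ge1$ for transitions removed as loop-entry transitions in the $n$-th multi-step ('loop-entry transitions'), label $0$ for all other transitions ('body transitions'). It is guarded if all of its loop-entry transitions are proper. A guarded LLEE-1-chart is a 1-chart that has a guarded LLEE-witness. **Coinductive proofs.** Let $S$ be $\mathcal{EL}$-based with $\mathsf{ACI}\sqsubseteq S$. A coinductive proof over $S$ of $e_1=e_2$ is a pair $\langle C,L\rangle$ of a weakly guarded 1-chart $C$ with start vertex $v_s$ and a function $L:V(C)\to Eq(A)$, $v\mapsto (L_1(v)=L_2(v))$, such that $L_1$ and $L_2$ are $S$-provable solutions of $C$ and $L_1(v_s)\equiv e_1$, $L_2(v_s)\equiv e_2$ (syntactic equality). It is LLEE-witnessed if $C$ is a guarded LLEE-1-chart. $e_1\overset{\mathrm{LLEE}}{=}_S e_2$ means that there is a LLEE-witnessed coinductive proof over $S$ of $e_1=e_2$. **The rules $\mathrm{LCoProof}_n$.** For $n\in\mathbb N$ (including $0$), the rule $\mathrm{LCoProof}_n$ permits to infer $e=f$ from premises $g_1=h_1,\dots,g_n=h_n$ provided $e\overset{\mathrm{LLEE}}{=}_{\mathsf{Mil}^-+\Gamma}f$ for $\Gamma=\{g_1=h_1,\dots,g_n=h_n\}$. -}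

module Defs where

open import Level using (Level; 0ℓ; _⊔_) renaming (suc to lsuc)
open import Data.Bool using (if_then_else_)
open import Data.Empty using (⊥)
open import Data.Fin using (Fin)
open import Data.Fin.Subset using (Subset) renaming (_∈_ to _∈ˢ_)
open import Data.Fin.Subset.Properties using (_∈?_)
open import Data.List using (List; []; _∷_; foldl; length; map)
open import Data.List.Membership.Propositional using (_∈_)
open import Data.List.Relation.Unary.All using (All; []; _∷_)
open import Data.Nat using (ℕ; zero; suc)
open import Data.Product using (Σ; ∃-syntax; Σ-syntax; _×_; _,_; proj₁; proj₂)
open import Data.Sum using (_⊎_; inj₁; inj₂)
open import Data.Unit using (⊤)
open import Function using (_∘_)
open import Function.Bundles using (_⇔_)
open import Relation.Binary.Construct.Closure.ReflexiveTransitive using (Star; ε; _◅_; _◅◅_)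
open import Relation.Binary.Construct.Closure.Transitive using (TransClosure)
open import Relation.Binary.PropositionalEquality using (_≡_; _≢_)
open import Relation.Nullary using (¬_; does)
open import Relation.Unary using (Pred)

private
  variable
    A : Set
    ℓ ℓ₁ ℓ₂ : Level

------------------------------------------------------------------------
-- Star expressions

infixl 6 _+_
infixl 7 _·_
infix  8 _*
infix  4 _≐_
infix  4 _↓

data StExp (A : Set) : Set where
  𝟎   : StExp A
  𝟏   : StExp A
  act : A → StExp A
  _+_ : StExp A → StExp A → StExp A
  _·_ : StExp A → StExp A → StExp A
  _*  : StExp A → StExp A

-- The sum of e₁, …, eₙ associates to the left, and ∑ (e ∷ []) is e itself.
∑ : List (StExp A) → StExp A
∑ []       = 𝟎
∑ (e ∷ es) = foldl _+_ e es

data _↓ {A : Set} : StExp A → Set where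
  𝟏↓  : 𝟏 ↓
  +↓ˡ : ∀ {e f} → e ↓ → (e + f) ↓
  +↓ʳ : ∀ {e f} → f ↓ → (e + f) ↓
  ·↓  : ∀ {e f} → e ↓ → f ↓ → (e · f) ↓
  *↓  : ∀ {e} → (e *) ↓

record Eq (A : Set) : Set where
  constructor _≐_
  field
    lhs rhs : StExp A

open Eq public

data Context (A : Set) : Set where
  □    : Context A
  _+ˡ_ : Context A → StExp A → Context A
  _+ʳ_ : StExp A → Context A → Context A
  _·ˡ_ : Context A → StExp A → Context A
  _·ʳ_ : StExp A → Context A → Context A
  _*ᶜ  : Context A → Context A

_[_] : Context A → StExp A → StExp A
□        [ e ] = e
(C +ˡ f) [ e ] = (C [ e ]) + f
(f +ʳ C) [ e ] = f + (C [ e ])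
(C ·ˡ f) [ e ] = (C [ e ]) · f
(f ·ʳ C) [ e ] = f · (C [ e ])
(C *ᶜ)   [ e ] = (C [ e ]) *

------------------------------------------------------------------------
-- Proof systems

-- R Γ φ is the type of instances of R with list of premises Γ and
-- conclusion φ; evidence for the side condition is part of the instance.
-- A proof system is the union of its rules, hence of the same type, with
-- axioms as rules without premises.
Rule : (A : Set) (ℓ : Level) → Set (lsuc ℓ)
Rule A ℓ = List (Eq A) → Eq A → Set ℓ

System : (A : Set) (ℓ : Level) → Set (lsuc ℓ)
System = Rule

infixl 5 _⊕_
infix  3 _⊢_

_⊕_ : System A ℓ₁ → Rule A ℓ₂ → System A (ℓ₁ ⊔ ℓ₂)
(S ⊕ R) Γ φ = S Γ φ ⊎ R Γ φ

data Axioms {A : Set} (P : Pred (Eq A) 0ℓ) : Rule A 0ℓ where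
  axiom : ∀ {φ} → P φ → Axioms P [] φ

-- Derivations without assumptions.
data _⊢_ {A : Set} {ℓ : Level} (S : System A ℓ) : Eq A → Set ℓ where
  infer : ∀ {Γ φ} → S Γ φ → All (S ⊢_) Γ → S ⊢ φ

module _ {S : System A ℓ₁} {R : Rule A ℓ₂} where

  weaken    : ∀ {φ} → S ⊢ φ → S ⊕ R ⊢ φ
  weakenAll : ∀ {Γ} → All (S ⊢_) Γ → All (S ⊕ R ⊢_) Γ

  weaken (infer r ds) = infer (inj₁ r) (weakenAll ds)

  weakenAll []       = []
  weakenAll (d ∷ ds) = weaken d ∷ weakenAll ds

-- The last inference is an instance of R, and all immediate subderivations
-- are derivations in S.
data Bottommost {A : Set} {ℓ₁ ℓ₂ : Level} (S : System A ℓ₁) (R : Rule A ℓ₂) :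
                {φ : Eq A} → S ⊕ R ⊢ φ → Set (ℓ₁ ⊔ ℓ₂) where
  bottommost : ∀ {Γ φ} (r : R Γ φ) (ds : All (S ⊢_) Γ) →
               Bottommost S R (infer (inj₂ r) (weakenAll ds))

-- R is correct for S.
Correct : Rule A ℓ₁ → System A ℓ₂ → Set (ℓ₁ ⊔ ℓ₂)
Correct R S = ∀ {φ} (D : S ⊕ R ⊢ φ) → Bottommost S R D → S ⊢ φ

Derivation : System A ℓ → Set ℓ
Derivation S = ∃[ φ ] S ⊢ φ

conclusion : {S : System A ℓ} → Derivation S → Eq A
conclusion = proj₁

-- A function that turns derivations as in the definition of correctness
-- into derivations in S with the same conclusion.
EffectivelyCorrect : Rule A ℓ₁ → System A ℓ₂ → Set (ℓ₁ ⊔ ℓ₂)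
EffectivelyCorrect R S =
  Σ[ transform ∈ ((D : Derivation (S ⊕ R)) → Bottommost S R (proj₂ D) → Derivation S) ]
    (∀ D b → conclusion (transform D b) ≡ conclusion D)

data EL {A : Set} : Rule A 0ℓ where
  reflexivity  : ∀ {e} → EL [] (e ≐ e)
  symmetry     : ∀ {e f} → EL ((e ≐ f) ∷ []) (f ≐ e)
  transitivity : ∀ {e f g} → EL ((e ≐ f) ∷ (f ≐ g) ∷ []) (e ≐ g)
  context      : ∀ {e f} (C : Context A) → EL ((e ≐ f) ∷ []) (C [ e ] ≐ C [ f ])

data MilAxiom {A : Set} : Eq A → Set where
  +-assoc     : ∀ {e f g} → MilAxiom ((e + f) + g ≐ e + (f + g))
  +-neutral   : ∀ {e} → MilAxiom (e + 𝟎 ≐ e)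
  +-comm      : ∀ {e f} → MilAxiom (e + f ≐ f + e)
  +-idem      : ∀ {e} → MilAxiom (e + e ≐ e)
  ·-assoc     : ∀ {e f g} → MilAxiom ((e · f) · g ≐ e · (f · g))
  ·-distrib-+ : ∀ {e f g} → MilAxiom ((e + f) · g ≐ e · g + f · g)
  ·-neutralˡ  : ∀ {e} → MilAxiom (𝟏 · e ≐ e)
  ·-neutralʳ  : ∀ {e} → MilAxiom (e · 𝟏 ≐ e)
  ·-zeroˡ     : ∀ {e} → MilAxiom (𝟎 · e ≐ 𝟎)
  *-unfold    : ∀ {e} → MilAxiom (e * ≐ 𝟏 + e · e *)
  *-guard     : ∀ {e} → MilAxiom (e * ≐ (𝟏 + e) *)

data RSP* {A : Set} : Rule A 0ℓ where
  rsp* : ∀ {e f g} → ¬ (f ↓) → RSP* ((e ≐ f · e + g) ∷ []) (e ≐ f * · g)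

Mil⁻ : System A 0ℓ
Mil⁻ = EL ⊕ Axioms MilAxiom

Mil : System A 0ℓ
Mil = Mil⁻ ⊕ RSP*

------------------------------------------------------------------------
-- 1-charts and provable solutions

data Label (A : Set) : Set where
  proper : A → Label A
  empty  : Label A

⟪_⟫ : Label A → StExp A
⟪ proper a ⟫ = act a
⟪ empty ⟫    = 𝟏

record 1-Chart (A : Set) : Set₁ where
  field
    size        : ℕ
  V : Set
  V = Fin size
  field
    start       : V
    _—[_]→_     : V → Label A → V → Set
    terminating : Subset size

  τ : V → StExp A
  τ v = if does (v ∈? terminating) then 𝟏 else 𝟎

WeaklyGuarded : 1-Chart A → Set
WeaklyGuarded C = ∀ v → ¬ TransClosure (λ x y → x —[ empty ]→ y) v v
  where open 1-Chart C

module _ (S : System A ℓ) (C : 1-Chart A) where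
  open 1-Chart C

  -- The list ts may contain repetitions.  Its existence is demanded, so only
  -- charts with finitely many transitions from each vertex have solutions.
  IsSolution : (V → StExp A) → Set ℓ
  IsSolution s = ∀ v → Σ[ ts ∈ List (Label A × V) ]
    (∀ a w → (a , w) ∈ ts ⇔ v —[ a ]→ w) ×
    (S ⊢ s v ≐ τ v + ∑ (map (λ (a , w) → ⟪ a ⟫ · s w) ts))

------------------------------------------------------------------------
-- Loop 1-charts

record InfinitePath {V : Set} (T : V → Label A → V → Set) : Set where
  field
    vertex : ℕ → V
    label  : ℕ → Label A
    step   : ∀ i → T (vertex i) (label i) (vertex (suc i))

open InfinitePath public using (vertex)

-- Immediate termination in a sub-1-chart is inherited from C.
record Sub-1-Chart (C : 1-Chart A) : Set₁ where
  open 1-Chart C using (V; _—[_]→_)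
  field
    Vertex  : V → Set
    Trans   : V → Label A → V → Set
    start   : V
    start∈  : Vertex start
    source∈ : ∀ {x a y} → Trans x a y → Vertex x
    target∈ : ∀ {x a y} → Trans x a y → Vertex y
    trans⊆  : ∀ {x a y} → Trans x a y → x —[ a ]→ y

whole : (C : 1-Chart A) → Sub-1-Chart C
whole C = record
  { Vertex  = λ _ → ⊤
  ; Trans   = _—[_]→_
  ; start   = start
  ; start∈  = _
  ; source∈ = _
  ; target∈ = _
  ; trans⊆  = λ t → t
  }
  where open 1-Chart C

record IsLoop {C : 1-Chart A} (L : Sub-1-Chart C) : Set where
  open Sub-1-Chart L
  field
    L1 : Σ[ p ∈ InfinitePath Trans ] vertex p 0 ≡ start
    L2 : (p : InfinitePath Trans) → vertex p 0 ≡ start → ∃[ k ] vertex p (suc k) ≡ start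
    L3 : ∀ v → Vertex v → v ∈ˢ 1-Chart.terminating C → v ≡ start

module _ {C : 1-Chart A} where
  open 1-Chart C using (V)

  -- A nonempty set U of transitions of D from a vertex v.
  record EntrySet (D : Sub-1-Chart C) : Set₁ where
    open Sub-1-Chart D using (Trans)
    field
      v        : V
      U        : Label A → V → Set
      U⊆       : ∀ {a w} → U a w → Trans v a w
      nonempty : ∃[ a ] ∃[ w ] U a w

  module _ {D : Sub-1-Chart C} (E : EntrySet D) where
    open Sub-1-Chart D
    open EntrySet E

    -- The transitions on paths that start with a transition in U and stop
    -- when v is reached again.  Paths that never get back to v count too:
    -- otherwise exits from the loop would be left out.
    data Generated : V → Label A → V → Set where
      entry  : ∀ {a w} → U a w → Generated v a w
      onward : ∀ {x a y b z} → Generated x a y → y ≢ v → Trans y b z → Generated y b z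

    data GeneratedVertex : V → Set where
      atStart  : GeneratedVertex v
      atTarget : ∀ {x a y} → Generated x a y → GeneratedVertex y

    generated : Sub-1-Chart C
    generated = record
      { Vertex  = GeneratedVertex
      ; Trans   = Generated
      ; start   = v
      ; start∈  = atStart
      ; source∈ = λ { (entry _) → atStart ; (onward t _ _) → atTarget t }
      ; target∈ = atTarget
      ; trans⊆  = λ { (entry u) → trans⊆ (U⊆ u) ; (onward _ _ t) → trans⊆ t }
      }

  record LoopSub-1-Chart (D : Sub-1-Chart C) : Set₁ where
    field
      entries : EntrySet D
      isLoop  : IsLoop (generated entries)
    open EntrySet entries public

  module _ {D : Sub-1-Chart C} (L : LoopSub-1-Chart D) where
    open LoopSub-1-Chart L

    LoopEntry : V → Label A → V → Set
    LoopEntry x a y = x ≡ v × U a y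

    -- The start vertex of a loop is not in its body.
    InBody : V → Set
    InBody x = GeneratedVertex entries x × x ≢ v

------------------------------------------------------------------------
-- Multi-step loop elimination and LLEE-witnesses

  -- Simultaneous elimination of suc m loop sub-1-charts.
  record MultiStep (D : Sub-1-Chart C) : Set₁ where
    field
      m         : ℕ
      loop      : Fin (suc m) → LoopSub-1-Chart D
      disjoint  : ∀ {i j} → i ≢ j → ∀ {x a y} →
                  LoopEntry (loop i) x a y → ¬ LoopEntry (loop j) x a y
      separated : ∀ {i j} → i ≢ j → ¬ InBody (loop j) (LoopSub-1-Chart.v (loop i))

    Removed : V → Label A → V → Set
    Removed x a y = ∃[ i ] LoopEntry (loop i) x a y

    StartOfLoop : V → Set
    StartOfLoop x = ∃[ i ] x ≡ LoopSub-1-Chart.v (loop i)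

    InSomeBody : V → Set
    InSomeBody x = ∃[ i ] InBody (loop i) x

  module _ {D : Sub-1-Chart C} (M : MultiStep D) where
    open Sub-1-Chart D
    open MultiStep M

    Remaining : V → Label A → V → Set
    Remaining x a y = Trans x a y × ¬ Removed x a y

    Reachable : V → Set
    Reachable = Star (λ x y → ∃[ a ] Remaining x a y) start

    eliminate : Sub-1-Chart C
    eliminate = record
      { Vertex  = Reachable
      ; Trans   = λ x a y → Reachable x × Remaining x a y
      ; start   = start
      ; start∈  = ε
      ; source∈ = proj₁
      ; target∈ = λ (r , t) → r ◅◅ ((_ , t) ◅ ε)
      ; trans⊆  = λ (_ , t , _) → trans⊆ t
      }

  data Run (D : Sub-1-Chart C) : Set₁ where
    done : Run D
    _then_ : (M : MultiStep D) → Run (eliminate M) → Run D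

  final : ∀ {D} → Run D → Sub-1-Chart C
  final {D} done   = D
  final (_ then r) = final r

  Successful : ∀ {D} → Run D → Set
  Successful r = ¬ InfinitePath (Sub-1-Chart.Trans (final r))

  LaterStart : ∀ {D} → Run D → V → Set
  LaterStart done       x = ⊥
  LaterStart (M then r) x = MultiStep.StartOfLoop M x ⊎ LaterStart r x

  Layered : ∀ {D} → Run D → Set
  Layered done       = ⊤
  Layered (M then r) = (∀ x → MultiStep.InSomeBody M x → ¬ LaterStart r x) × Layered r

  -- RemovedAt r n: removed as a loop-entry transition in the n-th multi-step
  -- of r, where multi-steps are counted from 1.
  RemovedAt : ∀ {D} → Run D → ℕ → V → Label A → V → Set
  RemovedAt _          zero          x a y = ⊥
  RemovedAt done       (suc n)       x a y = ⊥
  RemovedAt (M then r) (suc zero)    x a y = MultiStep.Removed M x a y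
  RemovedAt (M then r) (suc (suc n)) x a y = RemovedAt r (suc n) x a y

record LLEE-Witness (C : 1-Chart A) : Set₁ where
  open 1-Chart C
  field
    marking    : ∀ {x a y} → x —[ a ]→ y → ℕ
    run        : Run (whole C)
    successful : Successful run
    layered    : Layered run
    records    : ∀ {x a y} (t : x —[ a ]→ y) n →
                 marking t ≡ suc n ⇔ RemovedAt run (suc n) x a y

Guarded : {C : 1-Chart A} → LLEE-Witness C → Set
Guarded {C = C} W = ∀ {x a y} (t : x —[ a ]→ y) → marking t ≢ 0 → ∃[ b ] a ≡ proper b
  where open 1-Chart C
        open LLEE-Witness W

GuardedLLEE : 1-Chart A → Set₁
GuardedLLEE C = Σ (LLEE-Witness C) Guarded

------------------------------------------------------------------------
-- Coinductive proofs

record CoinductiveProof (S : System A ℓ) (φ : Eq A) : Set (lsuc 0ℓ ⊔ ℓ) where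
  field
    chart         : 1-Chart A
    weaklyGuarded : WeaklyGuarded chart
  open 1-Chart chart
  field
    L         : V → Eq A
    solution₁ : IsSolution S chart (lhs ∘ L)
    solution₂ : IsSolution S chart (rhs ∘ L)
    atStart₁  : lhs (L start) ≡ lhs φ
    atStart₂  : rhs (L start) ≡ rhs φ

LLEE-Provable : System A ℓ → Eq A → Set (lsuc 0ℓ ⊔ ℓ)
LLEE-Provable S φ = Σ[ P ∈ CoinductiveProof S φ ] GuardedLLEE (CoinductiveProof.chart P)

LCoProof : ℕ → Rule A (lsuc 0ℓ)
LCoProof n Γ φ = length Γ ≡ n × LLEE-Provable (Mil⁻ ⊕ Axioms (_∈ Γ)) φ

{-# OPTIONS --safe #-}
-- Eliminating loops one multi-step at a time turns the defining equations of a
-- solution s into equations s(w) = e · s(w) + (τ(w) + ∑ a · s(u)), in which the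
-- sum ranges over the transitions that have not been eliminated yet, and e,
-- which does not depend on s, collects the eliminated ones. As loop-entry
-- transitions are proper, e does not terminate immediately, so RSP* applies.
-- Inside the body of a loop at v no cycle avoids v, by (L2), hence well-founded
-- induction yields s(x) = t · s(v) with t independent of s; this absorbs the
-- entries of that loop into e. In the end no cycle is left, and a last
-- well-founded induction yields s(w) = r with r independent of s.
module Submission where

open import Defs
open import Algebra.Bundles using (CommutativeSemigroup)
open import Data.Empty using (⊥-elim)
open import Data.Fin using (Fin)
open import Data.Fin.Induction using (spo-noetherian)
open import Data.Fin.Properties using (_≟_)
open import Data.Fin.Subset using () renaming (_∈_ to _∈ˢ_)
open import Data.Fin.Subset.Properties using (_∈?_)
open import Data.List using (List; []; _∷_; foldl; map)
open import Data.List.Membership.Propositional using (_∈_)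
open import Data.List.Relation.Binary.Subset.Propositional using (_⊆_)
open import Data.List.Relation.Binary.Subset.Propositional.Properties using (map⁺)
open import Data.List.Relation.Unary.All as All using (All; []; _∷_)
open import Data.List.Relation.Unary.Any using (here; there)
open import Data.Nat using (ℕ; zero; suc)
import Data.Nat.Properties as ℕ
open import Data.Product using (Σ; ∃-syntax; Σ-syntax; _×_; _,_; proj₁; proj₂)
open import Data.Sum using (inj₁; inj₂)
open import Function using (_∘_; flip)
open import Function.Bundles using (module Equivalence)
open import Induction.WellFounded using (WellFounded; Acc; acc)
open import Level using (0ℓ)
open import Relation.Binary using (Rel; Setoid)
open import Relation.Binary.Construct.Closure.ReflexiveTransitive using (Star; ε; _◅_)
open import Relation.Binary.Construct.Closure.Transitive using (TransClosure; _∷_; _++_)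
  renaming ([_] to [_]⁺)
open import Relation.Binary.PropositionalEquality
  using (_≡_; _≢_; refl; sym; trans; cong; cong₂; subst; isEquivalence)
open import Relation.Nullary using (¬_; Dec; yes; no)
open import Relation.Nullary.Decidable using (map′)
import Relation.Binary.Reasoning.Setoid as SetoidReasoning

private
  variable
    A : Set

-- Equational reasoning in `Mil`.

infix 4 _≈_

_≈_ : StExp A → StExp A → Set
e ≈ f = Mil ⊢ e ≐ f

module _ {A : Set} where

  milAxiom : ∀ {φ : Eq A} → MilAxiom φ → Mil ⊢ φ
  milAxiom p = infer (inj₁ (inj₂ (axiom p))) []

  ≈-refl : {e : StExp A} → e ≈ e
  ≈-refl = infer (inj₁ (inj₁ reflexivity)) []

  ≈-sym : {e f : StExp A} → e ≈ f → f ≈ e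
  ≈-sym p = infer (inj₁ (inj₁ symmetry)) (p ∷ [])

  ≈-trans : {e f g : StExp A} → e ≈ f → f ≈ g → e ≈ g
  ≈-trans p q = infer (inj₁ (inj₁ transitivity)) (p ∷ q ∷ [])

  ≈-context : (K : Context A) {e f : StExp A} → e ≈ f → K [ e ] ≈ K [ f ]
  ≈-context K p = infer (inj₁ (inj₁ (context K))) (p ∷ [])

  ≈-setoid : Setoid 0ℓ 0ℓ
  ≈-setoid = record
    { Carrier       = StExp A
    ; _≈_           = _≈_
    ; isEquivalence = record { refl = ≈-refl ; sym = ≈-sym ; trans = ≈-trans }
    }

  open SetoidReasoning ≈-setoid

  +-congˡ : {e f g : StExp A} → f ≈ g → e + f ≈ e + g
  +-congˡ {e} = ≈-context (e +ʳ □)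

  +-congʳ : {e f g : StExp A} → f ≈ g → f + e ≈ g + e
  +-congʳ {e} = ≈-context (□ +ˡ e)

  +-cong : {e f g h : StExp A} → e ≈ f → g ≈ h → e + g ≈ f + h
  +-cong p q = ≈-trans (+-congʳ p) (+-congˡ q)

  ·-congˡ : {e f g : StExp A} → f ≈ g → e · f ≈ e · g
  ·-congˡ {e} = ≈-context (e ·ʳ □)

  +-commutativeSemigroup : CommutativeSemigroup 0ℓ 0ℓ
  +-commutativeSemigroup = record
    { Carrier = StExp A
    ; _≈_     = _≈_
    ; _∙_     = _+_
    ; isCommutativeSemigroup = record
      { isSemigroup = record
        { isMagma = record
          { isEquivalence = Setoid.isEquivalence ≈-setoid
          ; ∙-cong        = +-cong
          }
        ; assoc = λ _ _ _ → milAxiom +-assoc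
        }
      ; comm = λ _ _ → milAxiom +-comm
      }
    }

  open import Algebra.Properties.CommutativeSemigroup +-commutativeSemigroup
    using (x∙yz≈y∙xz)

  +-identityˡ : {e : StExp A} → 𝟎 + e ≈ e
  +-identityˡ = ≈-trans (milAxiom +-comm) (milAxiom +-neutral)

  foldl-+ : (e f : StExp A) (es : List (StExp A)) → foldl _+_ (e + f) es ≈ e + foldl _+_ f es
  foldl-+ e f []       = ≈-refl
  foldl-+ e f (g ∷ es) = begin
    foldl _+_ (e + f + g) es    ≈⟨ foldl-+ (e + f) g es ⟩
    e + f + foldl _+_ g es      ≈⟨ milAxiom +-assoc ⟩
    e + (f + foldl _+_ g es)    ≈⟨ +-congˡ (foldl-+ f g es) ⟨
    e + foldl _+_ (f + g) es    ∎

  ∑-∷ : (e : StExp A) (es : List (StExp A)) → ∑ (e ∷ es) ≈ e + ∑ es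
  ∑-∷ e []       = ≈-sym (milAxiom +-neutral)
  ∑-∷ e (f ∷ es) = foldl-+ e f es

  ∑-absorbs-∈ : ∀ {e : StExp A} {es} → e ∈ es → e + ∑ es ≈ ∑ es
  ∑-absorbs-∈ {e} {_ ∷ es} (here refl) = begin
    e + ∑ (e ∷ es)  ≈⟨ +-congˡ (∑-∷ e es) ⟩
    e + (e + ∑ es)  ≈⟨ milAxiom +-assoc ⟨
    e + e + ∑ es    ≈⟨ +-congʳ (milAxiom +-idem) ⟩
    e + ∑ es        ≈⟨ ∑-∷ e es ⟨
    ∑ (e ∷ es)      ∎
  ∑-absorbs-∈ {e} {f ∷ es} (there e∈) = begin
    e + ∑ (f ∷ es)  ≈⟨ +-congˡ (∑-∷ f es) ⟩
    e + (f + ∑ es)  ≈⟨ x∙yz≈y∙xz e f (∑ es) ⟩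
    f + (e + ∑ es)  ≈⟨ +-congˡ (∑-absorbs-∈ e∈) ⟩
    f + ∑ es        ≈⟨ ∑-∷ f es ⟨
    ∑ (f ∷ es)      ∎

  ∑-absorbs-⊆ : ∀ {es fs : List (StExp A)} → es ⊆ fs → ∑ es + ∑ fs ≈ ∑ fs
  ∑-absorbs-⊆ {[]}          _     = +-identityˡ
  ∑-absorbs-⊆ {e ∷ es} {fs} es⊆fs = begin
    ∑ (e ∷ es) + ∑ fs    ≈⟨ +-congʳ (∑-∷ e es) ⟩
    e + ∑ es + ∑ fs      ≈⟨ milAxiom +-assoc ⟩
    e + (∑ es + ∑ fs)    ≈⟨ +-congˡ (∑-absorbs-⊆ (es⊆fs ∘ there)) ⟩
    e + ∑ fs             ≈⟨ ∑-absorbs-∈ (es⊆fs (here refl)) ⟩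
    ∑ fs                 ∎

  -- By ACI each of the two sums absorbs the other. Provable solutions may list transitions in any
  -- order and with repetitions; this reconciles their equations.
  ∑-sameElements : ∀ {es fs : List (StExp A)} → es ⊆ fs → fs ⊆ es → ∑ es ≈ ∑ fs
  ∑-sameElements {es} {fs} es⊆fs fs⊆es = begin
    ∑ es         ≈⟨ ∑-absorbs-⊆ fs⊆es ⟨
    ∑ fs + ∑ es  ≈⟨ milAxiom +-comm ⟩
    ∑ es + ∑ fs  ≈⟨ ∑-absorbs-⊆ es⊆fs ⟩
    ∑ fs         ∎

  solve : {e f g : StExp A} → ¬ (f ↓) → e ≈ f · e + g → e ≈ f * · g
  solve f↓̸ p = infer (inj₂ (rsp* f↓̸)) (p ∷ [])

  𝟎↓̸ : ¬ (𝟎 {A = A} ↓)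
  𝟎↓̸ ()

  +↓̸ : {e f : StExp A} → ¬ (e ↓) → ¬ (f ↓) → ¬ (e + f ↓)
  +↓̸ e↓̸ f↓̸ (+↓ˡ e↓) = e↓̸ e↓
  +↓̸ e↓̸ f↓̸ (+↓ʳ f↓) = f↓̸ f↓

  act·↓̸ : ∀ {a} {e : StExp A} → ¬ (act a · e ↓)
  act·↓̸ (·↓ () _)

  module _ {Γ : List (Eq A)} (ds : All (Mil ⊢_) Γ) where

    -- Each use of a premise as an axiom is replaced by the derivation of that premise in `Mil`.
    cut    : ∀ {φ} → Mil⁻ ⊕ Axioms (_∈ Γ) ⊢ φ → Mil ⊢ φ
    cutAll : ∀ {Δ} → All (Mil⁻ ⊕ Axioms (_∈ Γ) ⊢_) Δ → All (Mil ⊢_) Δ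

    cut (infer (inj₁ r) es)         = infer (inj₁ r) (cutAll es)
    cut (infer (inj₂ (axiom φ∈)) _) = All.lookup ds φ∈

    cutAll []       = []
    cutAll (e ∷ es) = cut e ∷ cutAll es

-- Acyclicity, well-foundedness and infinite paths.

-- Acyclicity makes the transitive closure a strict partial order, and on a finite set such an order
-- is Noetherian. It is flipped so that recursion proceeds along transitions.
acyclic⇒noetherian : ∀ {n} {R : Rel (Fin n) 0ℓ} → (∀ x → ¬ TransClosure R x x) →
                     WellFounded (flip (TransClosure R))
acyclic⇒noetherian acyclic = spo-noetherian record
  { isEquivalence = isEquivalence
  ; irrefl        = λ { refl → acyclic _ }
  ; trans         = _++_
  ; <-resp-≈      = (λ { refl p → p }) , (λ { refl p → p })
  }

module _ {V : Set} {T : V → Label A → V → Set} where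

  Step : V → V → Set
  Step x y = ∃[ a ] T x a y

  module _ {z : V} (cycle : TransClosure Step z z) where

    private
      -- A vertex with the path to `z` still to be walked; once this path is used up, `next` starts
      -- over with `cycle`.
      State : Set
      State = Σ[ x ∈ V ] TransClosure Step x z

      next : State → State
      next (_ , [ _ ]⁺)   = z , cycle
      next (_ , (_ ∷ p)) = _ , p

      advance : (σ : State) → Step (proj₁ σ) (proj₁ (next σ))
      advance (_ , [ t ]⁺)   = t
      advance (_ , (t ∷ _)) = t

      run : State → ℕ → State
      run σ zero    = σ
      run σ (suc i) = next (run σ i)

    lasso : ∀ {x} → TransClosure Step x z → Σ[ p ∈ InfinitePath T ] vertex p 0 ≡ x
    lasso p = record
      { vertex = λ i → proj₁ (run (_ , p) i)
      ; label  = λ i → proj₁ (advance (run (_ , p) i))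
      ; step   = λ i → proj₂ (advance (run (_ , p) i))
      } , refl

-- Acyclicity of loop bodies.

module _ {C : 1-Chart A} {D : Sub-1-Chart C} (E : EntrySet D) where
  open 1-Chart C
  open Sub-1-Chart D
  open EntrySet E

  Generated⊆ : ∀ {x a y} → Generated E x a y → Trans x a y
  Generated⊆ (entry u)      = U⊆ u
  Generated⊆ (onward _ _ t) = t

  Inner : V → Label A → V → Set
  Inner x a y = Generated E x a y × y ≢ v

  -- `onward` continues only from vertices other than `v`, so the way in which a transition was
  -- generated is itself a path that never returns to `v`.
  innerPath : ∀ {x a y} → Generated E x a y → y ≢ v → TransClosure (Step {T = Inner}) v y
  innerPath g@(entry _)        y≢v = [ _ , g , y≢v ]⁺
  innerPath g@(onward h x≢v _) y≢v = innerPath h x≢v ++ [ _ , g , y≢v ]⁺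

  -- A cycle could be reached from `v` by `innerPath`; repeating it forever would give an infinite
  -- path from `v` that never returns, against (L2).
  inner-acyclic : IsLoop (generated E) → ∀ x → ¬ TransClosure (Step {T = Inner}) x x
  inner-acyclic isLoop x cycle = absurd (lasso cycle (pathTo cycle))
    where
    pathTo : ∀ {x y} → TransClosure (Step {T = Inner}) x y → TransClosure (Step {T = Inner}) v y
    pathTo [ _ , g , y≢v ]⁺ = innerPath g y≢v
    pathTo (_ ∷ p)          = pathTo p

    absurd : ¬ (Σ[ p ∈ InfinitePath Inner ] vertex p 0 ≡ v)
    absurd (p , p₀≡v) =
      let k , return = IsLoop.L2 isLoop (record
            { vertex = vertex p
            ; label  = InfinitePath.label p
            ; step   = λ i → proj₁ (InfinitePath.step p i)
            }) p₀≡v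
      in proj₂ (InfinitePath.step p k) return

-- Factors and values that are uniform in the solution.

-- ts lists the transitions of the chart.
module _ (C : 1-Chart A) (ts : 1-Chart.V C → List (Label A × 1-Chart.V C)) where
  open 1-Chart C
  open SetoidReasoning (≈-setoid {A}) hiding (start)
  open import Algebra.Properties.CommutativeSemigroup (+-commutativeSemigroup {A})
    using (x∙yz≈y∙xz)

  τ-zero : ∀ {v} → ¬ (v ∈ˢ terminating) → τ v ≡ 𝟎
  τ-zero {v} v∉ with v ∈? terminating
  ... | yes v∈ = ⊥-elim (v∉ v∈)
  ... | no  _  = refl

  term : (V → StExp A) → Label A × V → StExp A
  term s (a , w) = ⟪ a ⟫ · s w

  Solves : (V → StExp A) → Set
  Solves s = ∀ v → s v ≈ τ v + ∑ (map (term s) (ts v))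

  -- `t` is chosen before `s`, so one factor serves all solutions at once.
  Factors : V → V → Set
  Factors x v = ∃[ t ] (∀ s → Solves s → s x ≈ t · s v)

  factors-refl : ∀ {v} → Factors v v
  factors-refl = 𝟏 , λ _ _ → ≈-sym (milAxiom ·-neutralˡ)

  term-factors : ∀ {a u v} (F : Factors u v) s → Solves s →
                 term s (a , u) ≈ (⟪ a ⟫ · proj₁ F) · s v
  term-factors (_ , eq) s sol = ≈-trans (·-congˡ (eq s sol)) (≈-sym (milAxiom ·-assoc))

  ∑-factors : ∀ {v bs} → All (λ (_ , u) → Factors u v) bs →
              ∃[ g ] (∀ s → Solves s → ∑ (map (term s) bs) ≈ g · s v)
  ∑-factors [] = 𝟎 , λ _ _ → ≈-sym (milAxiom ·-zeroˡ)
  ∑-factors {v} {(a , u) ∷ bs} (F ∷ Fs) =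
    let g , eq = ∑-factors Fs
        f      = ⟪ a ⟫ · proj₁ F
    in f + g , λ s sol → begin
      ∑ (map (term s) ((a , u) ∷ bs))      ≈⟨ ∑-∷ _ (map (term s) bs) ⟩
      term s (a , u) + ∑ (map (term s) bs) ≈⟨ +-cong (term-factors F s sol) (eq s sol) ⟩
      f · s v + g · s v                    ≈⟨ milAxiom ·-distrib-+ ⟨
      (f + g) · s v                        ∎

  -- As `r` is chosen before `s`, any two solutions are provably equal at `w`.
  Determined : V → Set
  Determined w = ∃[ r ] (∀ s → Solves s → s w ≈ r)

  ∑-determined : ∀ {bs} → All (λ (_ , u) → Determined u) bs →
                 ∃[ r ] (∀ s → Solves s → ∑ (map (term s) bs) ≈ r)
  ∑-determined [] = 𝟎 , λ _ _ → ≈-refl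
  ∑-determined {(a , _) ∷ bs} ((r , eq) ∷ ds) =
    let r′ , eq′ = ∑-determined ds
    in ⟪ a ⟫ · r + r′ , λ s sol →
         ≈-trans (∑-∷ _ (map (term s) bs)) (+-cong (·-congˡ (eq s sol)) (eq′ s sol))

  -- Decomposed equations under loop elimination.

  -- `loops↓̸` is the side condition under which RSP* solves `equation` for `s w`. The summand `τ w`
  -- stays, since elimination removes transitions but not termination.
  record Decomposition (D : Sub-1-Chart C) (w : V) : Set where
    open Sub-1-Chart D
    field
      loops    : StExp A
      loops↓̸   : ¬ (loops ↓)
      rest     : List (Label A × V)
      rest⊆    : All (λ (a , u) → Trans w a u) rest
      equation : ∀ s → Solves s → s w ≈ loops · s w + (τ w + ∑ (map (term s) rest))

  open Decomposition

  Decomposed : Sub-1-Chart C → Set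
  Decomposed D = ∀ w → Sub-1-Chart.Vertex D w → Decomposition D w

  whole-decomposed : (∀ {a v w} → (a , w) ∈ ts v → v —[ a ]→ w) → Decomposed (whole C)
  whole-decomposed sound w _ = record
    { loops    = 𝟎
    ; loops↓̸   = 𝟎↓̸
    ; rest     = ts w
    ; rest⊆    = All.tabulate sound
    ; equation = λ s sol → begin
        s w                                       ≈⟨ sol w ⟩
        τ w + ∑ (map (term s) (ts w))             ≈⟨ +-identityˡ ⟨
        𝟎 + (τ w + ∑ (map (term s) (ts w)))       ≈⟨ +-congʳ (milAxiom ·-zeroˡ) ⟨
        𝟎 · s w + (τ w + ∑ (map (term s) (ts w))) ∎
    }

  -- Well-founded induction along the steps of the loop that do not return to `v`. By (L3) no body
  -- vertex terminates, so `τ x` vanishes; the summands from `rest` become multiples of `s v`, and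
  -- RSP* solves the resulting equation.
  body-factors : ∀ {D} → Decomposed D → (L : LoopSub-1-Chart D) →
                 ∀ x → InBody L x → Factors x (LoopSub-1-Chart.v L)
  body-factors {D} dec L x = go x (acyclic⇒noetherian (inner-acyclic entries isLoop) x)
    where
    open Sub-1-Chart D
    open LoopSub-1-Chart L

    go : ∀ x → Acc (flip (TransClosure (Step {T = Inner entries}))) x → InBody L x → Factors x v
    go x _ (atStart , x≢v) = ⊥-elim (x≢v refl)
    go x (acc rs) (atTarget g , x≢v) = d .loops * · h , λ s sol → begin
        s x                    ≈⟨ solve (d .loops↓̸) (loopEquation s sol) ⟩
        d .loops * · (h · s v) ≈⟨ milAxiom ·-assoc ⟨
        d .loops * · h · s v   ∎
      where
      d : Decomposition D x
      d = dec x (target∈ (Generated⊆ entries g))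

      τx≡𝟎 : τ x ≡ 𝟎
      τx≡𝟎 = τ-zero (x≢v ∘ IsLoop.L3 isLoop x (atTarget g))

      -- As `x` is not `v`, the loop contains every transition of `D` from `x`: its target is `v` or
      -- in the body again.
      successor : ∀ {a u} → Trans x a u → Factors u v
      successor {a} {u} t with u ≟ v
      ... | yes refl = factors-refl
      ... | no  u≢v  = go u (rs [ a , onward g x≢v t , u≢v ]⁺) (atTarget (onward g x≢v t) , u≢v)

      factored : ∃[ g ] (∀ s → Solves s → ∑ (map (term s) (d .rest)) ≈ g · s v)
      factored = ∑-factors (All.map successor (d .rest⊆))

      h : StExp A
      h = proj₁ factored

      loopEquation : ∀ s → Solves s → s x ≈ d .loops · s x + h · s v
      loopEquation s sol =
        let r = ∑ (map (term s) (d .rest)) in begin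
        s x                        ≈⟨ d .equation s sol ⟩
        d .loops · s x + (τ x + r) ≡⟨ cong (λ e → d .loops · s x + (e + r)) τx≡𝟎 ⟩
        d .loops · s x + (𝟎 + r)   ≈⟨ +-congˡ +-identityˡ ⟩
        d .loops · s x + r         ≈⟨ +-congˡ (proj₂ factored s sol) ⟩
        d .loops · s x + h · s v   ∎

  module _ {D : Sub-1-Chart C} (dec : Decomposed D) (M : MultiStep D)
           (removed? : ∀ {x a y} → Sub-1-Chart.Trans D x a y → Dec (MultiStep.Removed M x a y))
           (guarded : ∀ {x a y} → MultiStep.Removed M x a y → ∃[ b ] a ≡ proper b)
           where
    open Sub-1-Chart D
    open MultiStep M

    removed-factors : ∀ {w a u} → Removed w a u → Factors u w
    removed-factors {w} {a} {u} (i , w≡v , Uau) with u ≟ w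
    ... | yes refl = factors-refl
    ... | no  u≢w with refl ← w≡v = body-factors dec (loop i) u (atTarget (entry Uau) , u≢w)

    -- Each removed entry contributes its action times a factor from `removed-factors` to `e`.
    -- Guardedness makes that action proper, so the contribution does not terminate immediately.
    split : ∀ {w bs} → All (λ (a , u) → Trans w a u) bs →
            Σ[ e ∈ StExp A ] Σ[ cs ∈ List (Label A × V) ]
              ¬ (e ↓) ×
              All (λ (a , u) → Remaining M w a u) cs ×
              (∀ s → Solves s → ∑ (map (term s) bs) ≈ e · s w + ∑ (map (term s) cs))
    split [] = 𝟎 , [] , 𝟎↓̸ , [] , λ _ _ →
      ≈-sym (≈-trans (+-congʳ (milAxiom ·-zeroˡ)) +-identityˡ)
    split {w} {(a , u) ∷ bs} (t ∷ bs⊆) with e , cs , e↓̸ , cs⊆ , eq ← split bs⊆ | removed? t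
    ... | no ¬r = e , (a , u) ∷ cs , e↓̸ , (t , ¬r) ∷ cs⊆ , λ s sol → begin
      ∑ (map (term s) ((a , u) ∷ bs))                   ≈⟨ ∑-∷ _ (map (term s) bs) ⟩
      term s (a , u) + ∑ (map (term s) bs)              ≈⟨ +-congˡ (eq s sol) ⟩
      term s (a , u) + (e · s w + ∑ (map (term s) cs))  ≈⟨ x∙yz≈y∙xz _ _ _ ⟩
      e · s w + (term s (a , u) + ∑ (map (term s) cs))  ≈⟨ +-congˡ (∑-∷ _ (map (term s) cs)) ⟨
      e · s w + ∑ (map (term s) ((a , u) ∷ cs))         ∎
    ... | yes r with b , refl ← guarded r | F ← removed-factors r =
      act b · proj₁ F + e , cs , +↓̸ act·↓̸ e↓̸ , cs⊆ , λ s sol → begin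
      ∑ (map (term s) ((a , u) ∷ bs))                     ≈⟨ ∑-∷ _ (map (term s) bs) ⟩
      term s (a , u) + ∑ (map (term s) bs)
        ≈⟨ +-cong (term-factors F s sol) (eq s sol) ⟩
      act b · proj₁ F · s w + (e · s w + ∑ (map (term s) cs)) ≈⟨ milAxiom +-assoc ⟨
      act b · proj₁ F · s w + e · s w + ∑ (map (term s) cs)
        ≈⟨ +-congʳ (milAxiom ·-distrib-+) ⟨
      (act b · proj₁ F + e) · s w + ∑ (map (term s) cs)   ∎

    reachable⊆ : ∀ {x y} → Vertex x → Star (λ x y → ∃[ a ] Remaining M x a y) x y → Vertex y
    reachable⊆ x∈ ε                    = x∈
    reachable⊆ _  ((_ , t , _) ◅ path) = reachable⊆ (target∈ t) path

    eliminate-decomposed : Decomposed (eliminate M)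
    eliminate-decomposed w reach
      with d ← dec w (reachable⊆ start∈ reach)
      with e , cs , e↓̸ , cs⊆ , eq ← split (d .rest⊆) = record
      { loops    = d .loops + e
      ; loops↓̸   = +↓̸ (d .loops↓̸) e↓̸
      ; rest     = cs
      ; rest⊆    = All.map (reach ,_) cs⊆
      ; equation = λ s sol → begin
          s w
            ≈⟨ d .equation s sol ⟩
          d .loops · s w + (τ w + ∑ (map (term s) (d .rest)))
            ≈⟨ +-congˡ (+-congˡ (eq s sol)) ⟩
          d .loops · s w + (τ w + (e · s w + ∑ (map (term s) cs)))
            ≈⟨ +-congˡ (x∙yz≈y∙xz _ _ _) ⟩
          d .loops · s w + (e · s w + (τ w + ∑ (map (term s) cs)))
            ≈⟨ milAxiom +-assoc ⟨
          d .loops · s w + e · s w + (τ w + ∑ (map (term s) cs))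
            ≈⟨ +-congʳ (milAxiom ·-distrib-+) ⟨
          (d .loops + e) · s w + (τ w + ∑ (map (term s) cs))
            ∎
      }

  -- From successful runs to determined values.

  -- A cycle could be repeated forever, so the transitions are acyclic. Induction along them fixes
  -- the values of all targets in `rest` before RSP* solves for `s w`.
  noPath⇒determined : ∀ {D} → Decomposed D → ¬ InfinitePath (Sub-1-Chart.Trans D) →
                      ∀ w → Sub-1-Chart.Vertex D w → Determined w
  noPath⇒determined {D} dec noPath w =
    go w (acyclic⇒noetherian (λ _ cycle → noPath (proj₁ (lasso cycle cycle))) w)
    where
    open Sub-1-Chart D

    go : ∀ w → Acc (flip (TransClosure (Step {T = Trans}))) w → Vertex w → Determined w
    go w (acc rs) w∈ with d ← dec w w∈
      with r , eq ← ∑-determined (All.map (λ {(a , u)} t → go u (rs [ a , t ]⁺) (target∈ t)) (d .rest⊆))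
      = d .loops * · (τ w + r) , λ s sol →
          ≈-trans (solve (d .loops↓̸) (d .equation s sol)) (·-congˡ (+-congˡ (eq s sol)))

  -- Multi-steps are counted from 1, so `n` is the index counted from 0; it shifts by one when the
  -- first multi-step is taken off the run.
  run-determined : ∀ {D} → Decomposed D → (r : Run D) →
    (∀ {x a y} n → Sub-1-Chart.Trans D x a y → Dec (RemovedAt r (suc n) x a y)) →
    (∀ {x a y} n → Sub-1-Chart.Trans D x a y → RemovedAt r (suc n) x a y → ∃[ b ] a ≡ proper b) →
    Successful r → Determined (Sub-1-Chart.start D)
  run-determined {D} dec done _ _ successful =
    noPath⇒determined dec successful _ (Sub-1-Chart.start∈ D)
  run-determined {D} dec (M then r) removed? guarded successful =
    run-determined
      (eliminate-decomposed dec M (removed? 0) (λ q → guarded 0 (removed⊆ q) q)) r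
      (λ n (_ , t , _) → removed? (suc n) t)
      (λ n (_ , t , _) → guarded (suc n) t)
      successful
    where
    removed⊆ : ∀ {x a y} → MultiStep.Removed M x a y → Sub-1-Chart.Trans D x a y
    removed⊆ (i , refl , Uay) = LoopSub-1-Chart.U⊆ (MultiStep.loop M i) Uay

  -- Loop entries are given by arbitrary predicates; whether a transition is removed is decided by
  -- comparing its marking with the number of the multi-step. Removed transitions have nonzero
  -- marking, hence proper labels.
  start-determined : GuardedLLEE C → (∀ {a v w} → (a , w) ∈ ts v → v —[ a ]→ w) → Determined start
  start-determined (W , guarded) sound =
    run-determined (whole-decomposed sound) run
      (λ n t → map′ (to (records t n)) (from (records t n)) (marking t ℕ.≟ suc n))
      (λ n t q → guarded t (λ m≡0 → ℕ.0≢1+n (trans (sym m≡0) (from (records t n) q))))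
      successful
    where
    open LLEE-Witness W
    open Equivalence

-- From coinductive proofs to derivations in `Mil`.

-- Both sides of the coinductive proof solve the same chart, so at the start vertex both are
-- provably equal to one expression.
coinductive⇒Mil : ∀ {Γ} {φ : Eq A} → All (Mil ⊢_) Γ →
                  LLEE-Provable (Mil⁻ ⊕ Axioms (_∈ Γ)) φ → Mil ⊢ φ
coinductive⇒Mil {A} {φ = φ} ds (P , llee) =
  subst (Mil ⊢_) endpoints (≈-trans (proj₂ determined _ solves₁) (≈-sym (proj₂ determined _ solves₂)))
  where
  open CoinductiveProof P
  open 1-Chart chart
  open Equivalence

  ts : V → List (Label A × V)
  ts = proj₁ ∘ solution₁

  solves₁ : Solves chart ts (lhs ∘ L)
  solves₁ v = cut ds (proj₂ (proj₂ (solution₁ v)))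

  -- The second solution comes with its own list of transitions; it has the same elements as `ts v`,
  -- so the equation carries over.
  solves₂ : Solves chart ts (rhs ∘ L)
  solves₂ v =
    let us , us⇔ , eq = solution₂ v
        _  , ts⇔ , _  = solution₁ v
        us⊆ts : us ⊆ ts v
        us⊆ts = λ {(a , w)} → from (ts⇔ a w) ∘ to (us⇔ a w)
        ts⊆us : ts v ⊆ us
        ts⊆us = λ {(a , w)} → from (us⇔ a w) ∘ to (ts⇔ a w)
    in ≈-trans (cut ds eq) (+-congˡ (∑-sameElements (map⁺ _ us⊆ts) (map⁺ _ ts⊆us)))

  determined : Determined chart ts start
  determined = start-determined chart ts llee
    (λ {a} {v} {w} → to (proj₁ (proj₂ (solution₁ v)) a w))

  endpoints : (lhs (L start) ≐ rhs (L start)) ≡ φ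
  endpoints = cong₂ _≐_ atStart₁ atStart₂

LCoProof-correct : (n : ℕ) → Correct {A} (LCoProof n) Mil
LCoProof-correct n _ (bottommost (_ , P) ds) = coinductive⇒Mil ds P

lemma6p10 : (A : Set) →
    ((n : ℕ) → Correct {A} (LCoProof n) Mil) ×
    ((n : ℕ) → EffectivelyCorrect {A} (LCoProof n) Mil)
lemma6p10 A =
  LCoProof-correct ,
  λ n → (λ (φ , D) b → φ , LCoProof-correct n D b) , λ _ _ → refl
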